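{- Let $G$ be an $\mathfrak{M}_C$ group and $H\leq G$ a nilpotent subgroup. Then there exists a subgroup $D\leq G$, definable in the language of groups with parameters from $G$, such that $H\leq D$, $D$ is $N_G(H)$-normal, and $D$ is nilpotent of the same nilpotence class as $H$. Moreover, for every pair of positive integers $d$ and $n$ there exists a first-order formula $\phi_{d,n}(x,\overline{y})$ in the language of groups, with $\overline{y}$ a tuple of $dn$ variables, such that for every group $G$ of $c$-dimension $d$ and every subgroup $H\leq G$ nilpotent of class $n$, there exists a tuple $\overline{a}$ from $G$ such that $\phi_{d,n}(G,\overline{a})=\{g\in G : G\models\phi_{d,n}(g,\overline{a})\}$ is a subgroup of $G$ that is nilpotent of class $n$, contains $H$, and is $N_G(H)$-normal.
   Context: A group $G$ is $\mathfrak{M}_C$ (has the chain condition on centralizers) if there is no infinite sequence of subsets $A_n\subseteq G$ with $C_G(A_n)>C_G(A_{n+1})$ for all $n$. A group $G$ has finite centralizer dimension if there is a uniform bound on the length $n$ of chains $G=C_G(1)>C_G(A_1)>\dots>C_G(A_n)$ of centralizers of subsets $A_i\subseteq G$; the length of the longest such chain is the $c$-dimension $\dim(G)$ of $G$, and "$G$ has dimension $d$" means $\dim(G)=d$. For subgroups $A,B\leq G$, $A$ is $N_G(B)$-normal if $N_G(B)\leq N_G(A)$. Nilpotence class: the least $n\ge 0$ with $\gamma_{n+1}(G)=1$, where $\gamma_1(G)=G$, $\gamma_{k+1}(G)=[\gamma_k(G),G]$. -}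

module Defs where

open import Level using (Level; _⊔_; Lift; Setω) renaming (suc to lsuc)
open import Algebra.Bundles using (Group)
open import Data.Nat using (ℕ; zero; suc; _<_)
open import Data.Fin using (Fin; zero; suc)
open import Data.Product using (Σ; _×_; _,_; Σ-syntax)
open import Data.Sum using (_⊎_)
open import Data.Empty using (⊥)
open import Relation.Nullary using (¬_)
open import Relation.Unary using (Pred)

-- First-order language of groups (signature: ·, ⁻¹, e), de Bruijn
-- variables: a term/formula over k free variables x₀ … x_{k-1}.

data Term (k : ℕ) : Set where
  var  : Fin k → Term k
  e    : Term k
  _·_  : Term k → Term k → Term k
  inv  : Term k → Term k

data Formula : ℕ → Set where
  _≐_  : ∀ {k} → Term k → Term k → Formula k
  ⊥f   : ∀ {k} → Formula k
  ¬f_  : ∀ {k} → Formula k → Formula k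
  _∧f_ : ∀ {k} → Formula k → Formula k → Formula k
  _∨f_ : ∀ {k} → Formula k → Formula k → Formula k
  _⇒f_ : ∀ {k} → Formula k → Formula k → Formula k
  ∀f   : ∀ {k} → Formula (suc k) → Formula k   -- binds variable 0
  ∃f   : ∀ {k} → Formula (suc k) → Formula k   -- binds variable 0

extend : ∀ {a} {A : Set a} {k : ℕ} → A → (Fin k → A) → Fin (suc k) → A
extend x ρ zero    = x
extend x ρ (suc i) = ρ i

-- Universe-ω helpers (the uniform formula must not depend on the
-- universe levels of the groups it is applied to).
record _×ω_ (A B : Setω) : Setω where
  constructor _,ω_
  field
    fst : A
    snd : B

record ∃Formula (k : ℕ) (P : Formula k → Setω) : Setω where
  constructor _,φ_
  field
    formula : Formula k
    holds   : P formula

module _ {c ℓ : Level} (G : Group c ℓ) where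
  open Group G

  ⟦_⟧t : ∀ {k} → Term k → (Fin k → Carrier) → Carrier
  ⟦ var i ⟧t ρ = ρ i
  ⟦ e ⟧t ρ     = ε
  ⟦ t · s ⟧t ρ = ⟦ t ⟧t ρ ∙ ⟦ s ⟧t ρ
  ⟦ inv t ⟧t ρ = (⟦ t ⟧t ρ) ⁻¹

  Sat : ∀ {k} → Formula k → (Fin k → Carrier) → Set (c ⊔ ℓ)
  Sat (t ≐ s) ρ  = Lift c (⟦ t ⟧t ρ ≈ ⟦ s ⟧t ρ)
  Sat ⊥f ρ       = Lift (c ⊔ ℓ) ⊥
  Sat (¬f φ) ρ   = ¬ Sat φ ρ
  Sat (φ ∧f ψ) ρ = Sat φ ρ × Sat ψ ρ
  Sat (φ ∨f ψ) ρ = Sat φ ρ ⊎ Sat ψ ρ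
  Sat (φ ⇒f ψ) ρ = Sat φ ρ → Sat ψ ρ
  Sat (∀f φ) ρ   = (x : Carrier) → Sat φ (extend x ρ)
  Sat (∃f φ) ρ   = Σ[ x ∈ Carrier ] Sat φ (extend x ρ)

  Subset : Set (lsuc (c ⊔ ℓ))
  Subset = Pred Carrier (c ⊔ ℓ)

  _⊆_ : Subset → Subset → Set (c ⊔ ℓ)
  A ⊆ B = ∀ x → A x → B x

  _⊂_ : Subset → Subset → Set (c ⊔ ℓ)
  A ⊂ B = (A ⊆ B) × ¬ (B ⊆ A)

  C : Subset → Subset
  C A g = ∀ a → A a → g ∙ a ≈ a ∙ g

  MC : Set (lsuc (c ⊔ ℓ))
  MC = ¬ (Σ[ A ∈ (ℕ → Subset) ] (∀ m → C (A (suc m)) ⊂ C (A m)))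

  HasCentChain : ℕ → Set (lsuc (c ⊔ ℓ))
  HasCentChain k = Σ[ A ∈ (ℕ → Subset) ]
    ((∀ g → C (A zero) g) × (∀ i → i < k → C (A (suc i)) ⊂ C (A i)))

  HasCDim : ℕ → Set (lsuc (c ⊔ ℓ))
  HasCDim d = HasCentChain d × ¬ HasCentChain (suc d)

  record Subgroup : Set (lsuc (c ⊔ ℓ)) where
    field
      mem  : Subset
      resp : ∀ {x y} → x ≈ y → mem x → mem y
      ε∈   : mem ε
      ∙∈   : ∀ {x y} → mem x → mem y → mem (x ∙ y)
      ⁻¹∈  : ∀ {x} → mem x → mem (x ⁻¹)
  open Subgroup public

  data ⟨_⟩ (S : Subset) : Carrier → Set (c ⊔ ℓ) where
    gen  : ∀ {x} → S x → ⟨ S ⟩ x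
    unit : ⟨ S ⟩ ε
    mul  : ∀ {x y} → ⟨ S ⟩ x → ⟨ S ⟩ y → ⟨ S ⟩ (x ∙ y)
    inv′ : ∀ {x} → ⟨ S ⟩ x → ⟨ S ⟩ (x ⁻¹)
    cong′ : ∀ {x y} → x ≈ y → ⟨ S ⟩ x → ⟨ S ⟩ y

  [_,_] : Carrier → Carrier → Carrier
  [ x , y ] = (x ⁻¹) ∙ (y ⁻¹) ∙ x ∙ y

  -- lower central series of (the group) H:  γ H k = γ_{k+1}(H)
  -- γ_1(H) = H,  γ_{k+1}(H) = [γ_k(H), H]
  γ : Subset → ℕ → Subset
  γ H zero    = H
  γ H (suc k) = ⟨ (λ g → Σ[ x ∈ Carrier ] Σ[ h ∈ Carrier ]
                         (γ H k x × H h × (g ≈ [ x , h ]))) ⟩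

  Trivial : Subset → Set (c ⊔ ℓ)
  Trivial P = ∀ x → P x → x ≈ ε

  NilpotentOfClass : Subgroup → ℕ → Set (c ⊔ ℓ)
  NilpotentOfClass H n =
    Trivial (γ (mem H) n) × (∀ m → m < n → ¬ Trivial (γ (mem H) m))

  N : Subset → Subset
  N S g = ∀ h → (S h → S ((g ∙ h) ∙ (g ⁻¹))) × (S ((g ∙ h) ∙ (g ⁻¹)) → S h)

  IsNormalizerNormal : Subgroup → Subgroup → Set (c ⊔ ℓ)
  IsNormalizerNormal A B = N (mem B) ⊆ N (mem A)

  IsSubgroupOf : Subgroup → Subgroup → Set (c ⊔ ℓ)
  IsSubgroupOf H D = mem H ⊆ mem D

  DefinedBy : ∀ {k} → Formula (suc k) → (Fin k → Carrier) → Subset → Set (c ⊔ ℓ)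
  DefinedBy φ a D = ∀ g → (D g → Sat φ (extend g a)) × (Sat φ (extend g a) → D g)

  Definable : Subset → Set (c ⊔ ℓ)
  Definable D = Σ[ k ∈ ℕ ] Σ[ φ ∈ Formula (suc k) ] Σ[ a ∈ (Fin k → Carrier) ]
                  DefinedBy φ a D

{-# OPTIONS --safe #-}

-- Put E₀ = 1 and let Eₖ₊₁ consist of the x that normalize all earlier Eᵢ and satisfy
-- [x, γⱼ(H)] ⊆ Eₖ₊₁₋ⱼ for all j ≥ 1.  Since [γᵢ(H), γⱼ(H)] ≤ γᵢ₊ⱼ(H), a subgroup H of class n
-- lies in Eₙ, and so in D = { x ∈ Eₙ : [x, Eᵢ₊₁] ⊆ Eᵢ for all i }.  Descending through the Eᵢ,
-- D has class at most n, and D is N_G(H)-normal because its construction is canonical in H.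
--
-- For definability, the chain condition yields finitely many elements of each γⱼ(H) with the
-- same centralizer as γⱼ(H); at most d of them in dimension d, found greedily, each one
-- shrinking the centralizer.  By the Hall–Witt identity, in the definition of the Eₖ it is
-- enough to require the commutator condition for these elements.
module Submission where

open import Defs
open import Level using (Level; Lift; lift)
open import Algebra.Bundles using (Group)
import Algebra.Properties.Group as GroupProperties
open import Axiom.ExcludedMiddle using (ExcludedMiddle)
open import Data.Bool using (Bool; true; false; not)
open import Data.Empty using (⊥; ⊥-elim)
open import Data.Fin using (Fin; zero; suc; toℕ; fromℕ<; combine; remQuot; #_)
import Data.Fin as Fin
open import Data.Fin.Properties using (toℕ<n; toℕ-fromℕ<; remQuot-combine)
open import Data.List using (List; []; _∷_)
open import Data.Nat
  using (ℕ; zero; suc; _+_; _*_; _∸_; _⊔_; _≤_; _<_; z≤n; s≤s; _≤′_; ≤′-refl; ≤′-step)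
open import Data.Nat.Properties
  using (≤-refl; ≤-trans; ≤-reflexive; ≤-pred; ≤⇒≤′; <⇒≤; <⇒≱; ≤-<-connex; m≤n⇒m<n∨m≡n;
         m≤n⇒m≤1+n; m≤m+n; m≤n+m; +-monoˡ-≤; +-identityʳ; +-suc; +-comm; +-assoc; m∸n+n≡m;
         m≤m⊔n; m≤n⊔m)
open import Data.Product using (Σ; _×_; _,_; Σ-syntax; proj₁; proj₂)
open import Data.Sum using (_⊎_; inj₁; inj₂)
open import Data.Vec using (Vec; []; _∷_; lookup)
open import Function using (_∘_; _⇔_; mk⇔; Equivalence)
open import Relation.Binary.PropositionalEquality
  using (_≡_; refl; sym; trans; cong; cong₂; subst; subst₂)
open import Relation.Nullary using (¬_; yes; no)
open import Relation.Nullary.Decidable using (decidable-stable)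

-- Free reduction of group words.

Word : ℕ → Set
Word k = List (Bool × Fin k)

push : ∀ {k} → Bool → Fin k → Word k → Word k
push b i [] = (b , i) ∷ []
push true i ((false , j) ∷ w) with i Fin.≟ j
... | yes _ = w
... | no  _ = (true , i) ∷ (false , j) ∷ w
push false i ((true , j) ∷ w) with i Fin.≟ j
... | yes _ = w
... | no  _ = (false , i) ∷ (true , j) ∷ w
push b i w = (b , i) ∷ w

-- Prepends to a reduced word the reduced form of the term (or, for the flag
-- false, of its inverse).
reduce : ∀ {k} → Bool → Term k → Word k → Word k
reduce b     (var i) w = push b i w
reduce b     e       w = w
reduce true  (s · t) w = reduce true s (reduce true t w)
reduce false (s · t) w = reduce false t (reduce false s w)
reduce b     (inv t) w = reduce (not b) t w

-- First-order formulas for the Eₖ and for D.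

⁅_,_⁆ᵗ : ∀ {k} → Term k → Term k → Term k
⁅ s , t ⁆ᵗ = ((inv s · inv t) · s) · t

_◃ᵗ_ : ∀ {k} → Term k → Term k → Term k
s ◃ᵗ t = (s · t) · inv s

⋀ : ∀ {n k} → (Fin n → Formula k) → Formula k
⋀ {zero}  F = ¬f ⊥f
⋀ {suc n} F = F zero ∧f ⋀ (F ∘ suc)

weaken : ∀ {k} → Term k → Term (suc k)
weaken (var i) = var (suc i)
weaken e       = e
weaken (s · t) = weaken s · weaken t
weaken (inv t) = inv (weaken t)

-- The variables of the parameters b j i, where b j lists elements of γⱼ₊₁(H).
Params : (d n k : ℕ) → Set
Params d n k = Fin n → Fin d → Fin k

-- Taking an arbitrary term in an arbitrary context lets a predicate be applied to commutators and
-- conjugates, and below quantifiers, with no substitution into formulas.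
TermPredicate : (d n : ℕ) → Set
TermPredicate d n = ∀ {k} → Params d n k → Term k → Formula k

weakenParams : ∀ {d n k} → Params d n k → Params d n (suc k)
weakenParams p j i = suc (p j i)

inNormalizer : ∀ {d n} → TermPredicate d n → TermPredicate d n
inNormalizer S p t = ∀f
  ((S (weakenParams p) (var zero) ⇒f S (weakenParams p) (weaken t ◃ᵗ var zero)) ∧f
   (S (weakenParams p) (weaken t ◃ᵗ var zero) ⇒f S (weakenParams p) (var zero)))

-- Follows the recursion of `E`, but with finitely many parameters `p j i` in place of all of
-- γⱼ₊₁(H), and with `j` cut off at `n`.
inE : ∀ {d n} → ℕ → ℕ → TermPredicate d n
inE zero    j       p t = t ≐ e
inE (suc m) zero    p t = ⋀ λ j → inNormalizer (inE m (toℕ j)) p t ∧f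
                                  ⋀ λ i → inE m (toℕ j) p ⁅ t , var (p j i) ⁆ᵗ
inE (suc m) (suc j) p t = inE m j p t

inEnvelope : ∀ {d n} → TermPredicate d n
inEnvelope {n = n} p t = inE n 0 p t ∧f
  ⋀ {n} λ j → ∀f (inE n (toℕ j) (weakenParams p) (var zero) ⇒f
                  inE n (suc (toℕ j)) (weakenParams p) ⁅ weaken t , var zero ⁆ᵗ)

envelopeFormula : (d n : ℕ) → Formula (suc (d * n))
envelopeFormula d n = inEnvelope {d} {n} (λ j i → suc (combine i j)) (var zero)

-- A solver for identities of the free group.

module GroupSolver {c ℓ} (G : Group c ℓ) where
  open Group G renaming (refl to ≈-refl; sym to ≈-sym; trans to ≈-trans)
  open GroupProperties G using (⁻¹-involutive; ⁻¹-anti-homo-∙; ε⁻¹≈ε)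
  open import Relation.Binary.Reasoning.Setoid setoid

  ⟦_⟧ʷ : ∀ {k} → Word k → (Fin k → Carrier) → Carrier
  ⟦ [] ⟧ʷ ρ              = ε
  ⟦ (true , i) ∷ w ⟧ʷ ρ  = ρ i ∙ ⟦ w ⟧ʷ ρ
  ⟦ (false , i) ∷ w ⟧ʷ ρ = ρ i ⁻¹ ∙ ⟦ w ⟧ʷ ρ

  signed : Bool → Carrier → Carrier
  signed true  x = x
  signed false x = x ⁻¹

  cancelˡ : ∀ {x y z} → x ∙ y ≈ ε → z ≈ x ∙ (y ∙ z)
  cancelˡ {x} {y} {z} xy≈ε = begin
    z           ≈⟨ identityˡ z ⟨
    ε ∙ z       ≈⟨ ∙-congʳ xy≈ε ⟨
    x ∙ y ∙ z   ≈⟨ assoc x y z ⟩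
    x ∙ (y ∙ z) ∎

  push-correct : ∀ {k} b i (w : Word k) ρ → ⟦ push b i w ⟧ʷ ρ ≈ signed b (ρ i) ∙ ⟦ w ⟧ʷ ρ
  push-correct true  i [] ρ = ≈-refl
  push-correct false i [] ρ = ≈-refl
  push-correct true  i ((true , j) ∷ w) ρ = ≈-refl
  push-correct false i ((false , j) ∷ w) ρ = ≈-refl
  push-correct true  i ((false , j) ∷ w) ρ with i Fin.≟ j
  ... | yes refl = cancelˡ (inverseʳ (ρ i))
  ... | no  _    = ≈-refl
  push-correct false i ((true , j) ∷ w) ρ with i Fin.≟ j
  ... | yes refl = cancelˡ (inverseˡ (ρ i))
  ... | no  _    = ≈-refl

  signed-ε : ∀ b → signed b ε ≈ ε
  signed-ε true  = ≈-refl
  signed-ε false = ε⁻¹≈ε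

  signed-not : ∀ b x → signed (not b) x ≈ signed b (x ⁻¹)
  signed-not true  x = ≈-refl
  signed-not false x = ≈-sym (⁻¹-involutive x)

  reduce-correct : ∀ {k} b (t : Term k) w ρ →
                   ⟦ reduce b t w ⟧ʷ ρ ≈ signed b (⟦_⟧t G t ρ) ∙ ⟦ w ⟧ʷ ρ
  reduce-correct b (var i) w ρ = push-correct b i w ρ
  reduce-correct b e w ρ = begin
    ⟦ w ⟧ʷ ρ              ≈⟨ identityˡ _ ⟨
    ε ∙ ⟦ w ⟧ʷ ρ          ≈⟨ ∙-congʳ (signed-ε b) ⟨
    signed b ε ∙ ⟦ w ⟧ʷ ρ ∎
  reduce-correct true (s · t) w ρ = begin
    ⟦ reduce true s (reduce true t w) ⟧ʷ ρ        ≈⟨ reduce-correct true s _ ρ ⟩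
    ⟦_⟧t G s ρ ∙ ⟦ reduce true t w ⟧ʷ ρ           ≈⟨ ∙-congˡ (reduce-correct true t w ρ) ⟩
    ⟦_⟧t G s ρ ∙ (⟦_⟧t G t ρ ∙ ⟦ w ⟧ʷ ρ)          ≈⟨ assoc _ _ _ ⟨
    ⟦_⟧t G s ρ ∙ ⟦_⟧t G t ρ ∙ ⟦ w ⟧ʷ ρ            ∎
  reduce-correct false (s · t) w ρ = begin
    ⟦ reduce false t (reduce false s w) ⟧ʷ ρ          ≈⟨ reduce-correct false t _ ρ ⟩
    ⟦_⟧t G t ρ ⁻¹ ∙ ⟦ reduce false s w ⟧ʷ ρ           ≈⟨ ∙-congˡ (reduce-correct false s w ρ) ⟩
    ⟦_⟧t G t ρ ⁻¹ ∙ (⟦_⟧t G s ρ ⁻¹ ∙ ⟦ w ⟧ʷ ρ)        ≈⟨ assoc _ _ _ ⟨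
    ⟦_⟧t G t ρ ⁻¹ ∙ ⟦_⟧t G s ρ ⁻¹ ∙ ⟦ w ⟧ʷ ρ          ≈⟨ ∙-congʳ (⁻¹-anti-homo-∙ _ _) ⟨
    (⟦_⟧t G s ρ ∙ ⟦_⟧t G t ρ) ⁻¹ ∙ ⟦ w ⟧ʷ ρ           ∎
  reduce-correct b (inv t) w ρ = begin
    ⟦ reduce (not b) t w ⟧ʷ ρ                 ≈⟨ reduce-correct (not b) t w ρ ⟩
    signed (not b) (⟦_⟧t G t ρ) ∙ ⟦ w ⟧ʷ ρ    ≈⟨ ∙-congʳ (signed-not b _) ⟩
    signed b (⟦_⟧t G t ρ ⁻¹) ∙ ⟦ w ⟧ʷ ρ       ∎

  normalise-correct : ∀ {k} (t : Term k) ρ → ⟦ reduce true t [] ⟧ʷ ρ ≈ ⟦_⟧t G t ρ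
  normalise-correct t ρ = ≈-trans (reduce-correct true t [] ρ) (identityʳ _)

  -- Each term has the value of its reduced word in every group, and an identity of the free group
  -- has the same reduced word on both sides; then `refl` serves as the third argument.
  solve : ∀ {k} (s t : Term k) → reduce true s [] ≡ reduce true t [] →
          (ρ : Vec Carrier k) → ⟦_⟧t G s (lookup ρ) ≈ ⟦_⟧t G t (lookup ρ)
  solve s t eq ρ = begin
    ⟦_⟧t G s (lookup ρ)             ≈⟨ normalise-correct s _ ⟨
    ⟦ reduce true s [] ⟧ʷ (lookup ρ) ≡⟨ cong (λ w → ⟦ w ⟧ʷ (lookup ρ)) eq ⟩
    ⟦ reduce true t [] ⟧ʷ (lookup ρ) ≈⟨ normalise-correct t _ ⟩
    ⟦_⟧t G t (lookup ρ)             ∎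

module _ {c ℓ : Level} (G : Group c ℓ) where
  open Group G renaming (refl to ≈-refl; sym to ≈-sym; trans to ≈-trans)
  open GroupProperties G using (ε⁻¹≈ε)
  open GroupSolver G using (solve)

  -- Commutators, conjugation and normalizers.

  private
    ⁅_,_⁆ : Carrier → Carrier → Carrier
    ⁅_,_⁆ = [_,_] G

    infix 7.5 _◃_
    _◃_ : Carrier → Carrier → Carrier
    g ◃ x = (g ∙ x) ∙ g ⁻¹

    v₀ : ∀ {k} → Term (suc k)
    v₀ = var (# 0)
    v₁ : ∀ {k} → Term (suc (suc k))
    v₁ = var (# 1)
    v₂ : ∀ {k} → Term (suc (suc (suc k)))
    v₂ = var (# 2)

  ⁅⁆-congˡ : ∀ {x y z} → x ≈ y → ⁅ x , z ⁆ ≈ ⁅ y , z ⁆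
  ⁅⁆-congˡ x≈y = ∙-congʳ (∙-cong (∙-congʳ (⁻¹-cong x≈y)) x≈y)

  ⁅⁆-congʳ : ∀ {x y z} → y ≈ z → ⁅ x , y ⁆ ≈ ⁅ x , z ⁆
  ⁅⁆-congʳ y≈z = ∙-cong (∙-congʳ (∙-congˡ (⁻¹-cong y≈z))) y≈z

  ⁅ε,⁆ : ∀ x → ⁅ ε , x ⁆ ≈ ε
  ⁅ε,⁆ x = solve ⁅ e , v₀ ⁆ᵗ e refl (x ∷ [])

  ⁅,ε⁆ : ∀ x → ⁅ x , ε ⁆ ≈ ε
  ⁅,ε⁆ x = solve ⁅ v₀ , e ⁆ᵗ e refl (x ∷ [])

  ⁅⁆≈ε⇒commute : ∀ {x y} → ⁅ x , y ⁆ ≈ ε → x ∙ y ≈ y ∙ x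
  ⁅⁆≈ε⇒commute {x} {y} eq =
    ≈-trans (solve (v₀ · v₁) ((v₁ · v₀) · ⁅ v₀ , v₁ ⁆ᵗ) refl (x ∷ y ∷ []))
            (≈-trans (∙-congˡ eq) (identityʳ _))

  commute⇒⁅⁆≈ε : ∀ {x y} → x ∙ y ≈ y ∙ x → ⁅ x , y ⁆ ≈ ε
  commute⇒⁅⁆≈ε {x} {y} eq =
    ≈-trans (solve ⁅ v₀ , v₁ ⁆ᵗ (inv (v₁ · v₀) · (v₀ · v₁)) refl (x ∷ y ∷ []))
            (≈-trans (∙-congˡ eq) (inverseˡ _))

  ◃-cong : ∀ {g h x y} → g ≈ h → x ≈ y → g ◃ x ≈ h ◃ y
  ◃-cong g≈h x≈y = ∙-cong (∙-cong g≈h x≈y) (⁻¹-cong g≈h)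

  ◃-◃⁻¹ : ∀ g x → g ◃ (g ⁻¹ ◃ x) ≈ x
  ◃-◃⁻¹ g x = solve (v₀ ◃ᵗ (inv v₀ ◃ᵗ v₁)) v₁ refl (g ∷ x ∷ [])

  ◃⁻¹-◃ : ∀ g x → g ⁻¹ ◃ (g ◃ x) ≈ x
  ◃⁻¹-◃ g x = solve (inv v₀ ◃ᵗ (v₀ ◃ᵗ v₁)) v₁ refl (g ∷ x ∷ [])

  normalizes : (K : Subgroup G) → ∀ {g} → (∀ x → mem K x → mem K (g ◃ x)) →
               (∀ x → mem K x → mem K (g ⁻¹ ◃ x)) → N G (mem K) g
  normalizes K {g} to from x = to x , λ gx∈K → resp K (◃⁻¹-◃ g x) (from _ gx∈K)

  normalizer : Subgroup G → Subgroup G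
  normalizer K .mem = N G (mem K)
  normalizer K .resp x≈y x∈N h =
    (λ h∈K → resp K (◃-cong x≈y ≈-refl) (proj₁ (x∈N h) h∈K)) ,
    (λ k → proj₂ (x∈N h) (resp K (◃-cong (≈-sym x≈y) ≈-refl) k))
  normalizer K .ε∈ h = resp K (solve v₀ (e ◃ᵗ v₀) refl (h ∷ [])) ,
                       resp K (solve (e ◃ᵗ v₀) v₀ refl (h ∷ []))
  normalizer K .∙∈ {x} {y} x∈N y∈N h =
    (λ h∈K → resp K (≈-sym ◃-∙) (proj₁ (x∈N _) (proj₁ (y∈N h) h∈K))) ,
    (λ k → proj₂ (y∈N h) (proj₂ (x∈N _) (resp K ◃-∙ k)))
    where
    ◃-∙ : (x ∙ y) ◃ h ≈ x ◃ (y ◃ h)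
    ◃-∙ = solve ((v₀ · v₁) ◃ᵗ v₂) (v₀ ◃ᵗ (v₁ ◃ᵗ v₂)) refl (x ∷ y ∷ h ∷ [])
  normalizer K .⁻¹∈ {x} x∈N h =
    (λ h∈K → proj₂ (x∈N _) (resp K (≈-sym (◃-◃⁻¹ x h)) h∈K)) ,
    (λ k → resp K (◃-◃⁻¹ x h) (proj₁ (x∈N _) k))

  self-normalizing : (K : Subgroup G) → IsSubgroupOf G K (normalizer K)
  self-normalizing K g g∈K = normalizes K
    (λ x x∈K → ∙∈ K (∙∈ K g∈K x∈K) (⁻¹∈ K g∈K))
    (λ x x∈K → ∙∈ K (∙∈ K (⁻¹∈ K g∈K) x∈K) (⁻¹∈ K (⁻¹∈ K g∈K)))

  _∩_ : Subgroup G → Subgroup G → Subgroup G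
  (K ∩ L) .mem x = mem K x × mem L x
  (K ∩ L) .resp x≈y (k , l) = resp K x≈y k , resp L x≈y l
  (K ∩ L) .ε∈ = ε∈ K , ε∈ L
  (K ∩ L) .∙∈ (k , l) (k′ , l′) = ∙∈ K k k′ , ∙∈ L l l′
  (K ∩ L) .⁻¹∈ (k , l) = ⁻¹∈ K k , ⁻¹∈ L l

  ∩-normal : (K L : Subgroup G) → ∀ {g} → N G (mem K) g → N G (mem L) g →
             N G (mem (K ∩ L)) g
  ∩-normal K L gK gL x =
    (λ (k , l) → proj₁ (gK x) k , proj₁ (gL x) l) ,
    (λ (k , l) → proj₂ (gK x) k , proj₂ (gL x) l)

  module _ (K : Subgroup G) where

    ⁅⁆∈-swap : ∀ {x y} → mem K ⁅ x , y ⁆ → mem K ⁅ y , x ⁆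
    ⁅⁆∈-swap {x} {y} xy = resp K
      (solve (inv ⁅ v₀ , v₁ ⁆ᵗ) ⁅ v₁ , v₀ ⁆ᵗ refl (x ∷ y ∷ [])) (⁻¹∈ K xy)

    -- `[xy, z] = y⁻¹[x, z]y · [y, z]`, and `y` normalizes `K`.
    ⁅∙,⁆∈ : ∀ {x y z} → N G (mem K) y → mem K ⁅ x , z ⁆ → mem K ⁅ y , z ⁆ →
            mem K ⁅ x ∙ y , z ⁆
    ⁅∙,⁆∈ {x} {y} {z} yN xz yz = resp K
      (solve ((inv v₁ ◃ᵗ ⁅ v₀ , v₂ ⁆ᵗ) · ⁅ v₁ , v₂ ⁆ᵗ) ⁅ v₀ · v₁ , v₂ ⁆ᵗ refl
             (x ∷ y ∷ z ∷ []))
      (∙∈ K (proj₁ (⁻¹∈ (normalizer K) yN _) xz) yz)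

    ⁅⁻¹,⁆∈ : ∀ {x z} → N G (mem K) x → mem K ⁅ x , z ⁆ → mem K ⁅ x ⁻¹ , z ⁆
    ⁅⁻¹,⁆∈ {x} {z} xN xz = resp K
      (solve (v₀ ◃ᵗ inv ⁅ v₀ , v₁ ⁆ᵗ) ⁅ inv v₀ , v₁ ⁆ᵗ refl (x ∷ z ∷ []))
      (proj₁ (xN _) (⁻¹∈ K xz))

    ⁅,∙⁆∈ : ∀ {x y z} → N G (mem K) z → mem K ⁅ x , y ⁆ → mem K ⁅ x , z ⁆ →
            mem K ⁅ x , y ∙ z ⁆
    ⁅,∙⁆∈ zN xy xz = ⁅⁆∈-swap (⁅∙,⁆∈ zN (⁅⁆∈-swap xy) (⁅⁆∈-swap xz))

    ⁅,⁻¹⁆∈ : ∀ {x z} → N G (mem K) z → mem K ⁅ x , z ⁆ → mem K ⁅ x , z ⁻¹ ⁆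
    ⁅,⁻¹⁆∈ zN xz = ⁅⁆∈-swap (⁅⁻¹,⁆∈ zN (⁅⁆∈-swap xz))

    -- The Hall–Witt identity.
    ⁅⁅⁆⁆∈ : ∀ {x y z} → N G (mem K) x → N G (mem K) y → N G (mem K) z →
            mem K ⁅ ⁅ y ⁻¹ , z ⁻¹ ⁆ , x ⁆ → mem K ⁅ ⁅ z , x ⁻¹ ⁆ , y ⁻¹ ⁆ →
            mem K ⁅ ⁅ x , y ⁆ , z ⁆
    ⁅⁅⁆⁆∈ {x} {y} {z} xN yN zN yzx zxy = resp K
      (solve (inv v₁ ◃ᵗ inv ((inv v₂ ◃ᵗ ⁅ ⁅ inv v₁ , inv v₂ ⁆ᵗ , v₀ ⁆ᵗ)
                             · (inv v₀ ◃ᵗ ⁅ ⁅ v₂ , inv v₀ ⁆ᵗ , inv v₁ ⁆ᵗ)))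
             ⁅ ⁅ v₀ , v₁ ⁆ᵗ , v₂ ⁆ᵗ refl (x ∷ y ∷ z ∷ []))
      (proj₁ (⁻¹∈ (normalizer K) yN _)
        (⁻¹∈ K (∙∈ K (proj₁ (⁻¹∈ (normalizer K) zN _) yzx)
                     (proj₁ (⁻¹∈ (normalizer K) xN _) zxy))))

  -- Stabilizers and auxiliary subgroups.

  Stabilizes : (ℕ → Subgroup G) → (ℕ → Subset G) → Subset G
  Stabilizes K A x = ∀ j → N G (mem (K j)) x × (∀ a → A j a → mem (K j) ⁅ x , a ⁆)

  -- The normalizer condition is what closes the commutator condition under products and inverses.
  stabilizer : (ℕ → Subgroup G) → (ℕ → Subset G) → Subgroup G
  stabilizer K A .mem = Stabilizes K A
  stabilizer K A .resp x≈y s j =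
    resp (normalizer (K j)) x≈y (proj₁ (s j)) ,
    λ a a∈A → resp (K j) (⁅⁆-congˡ x≈y) (proj₂ (s j) a a∈A)
  stabilizer K A .ε∈ j =
    ε∈ (normalizer (K j)) , λ a _ → resp (K j) (≈-sym (⁅ε,⁆ a)) (ε∈ (K j))
  stabilizer K A .∙∈ s t j =
    ∙∈ (normalizer (K j)) (proj₁ (s j)) (proj₁ (t j)) ,
    λ a a∈A → ⁅∙,⁆∈ (K j) (proj₁ (t j)) (proj₂ (s j) a a∈A) (proj₂ (t j) a a∈A)
  stabilizer K A .⁻¹∈ s j =
    ⁻¹∈ (normalizer (K j)) (proj₁ (s j)) ,
    λ a a∈A → ⁅⁻¹,⁆∈ (K j) (proj₁ (s j)) (proj₂ (s j) a a∈A)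

  -- `[gxg⁻¹, a] = g[x, g⁻¹ag]g⁻¹`, where `g⁻¹ag` lies in `A j` again and the outer conjugation
  -- preserves `K j`.
  stabilizer-normal : (K A : ℕ → Subgroup G) → ∀ {g} →
    (∀ j → N G (mem (K j)) g) → (∀ j → N G (mem (A j)) g) →
    N G (Stabilizes K (λ j → mem (A j))) g
  stabilizer-normal K A gK gA = normalizes (stabilizer K (λ j → mem (A j)))
    (λ x → conj gK gA)
    (λ x → conj (λ j → ⁻¹∈ (normalizer (K j)) (gK j)) (λ j → ⁻¹∈ (normalizer (A j)) (gA j)))
    where
    conj : ∀ {g x} → (∀ j → N G (mem (K j)) g) → (∀ j → N G (mem (A j)) g) →
           Stabilizes K (λ j → mem (A j)) x → Stabilizes K (λ j → mem (A j)) (g ◃ x)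
    conj {g} {x} gK gA s j =
      ∙∈ NK (∙∈ NK (gK j) (proj₁ (s j))) (⁻¹∈ NK (gK j)) ,
      λ a a∈A → resp (K j)
        (solve (v₀ ◃ᵗ ⁅ v₁ , inv v₀ ◃ᵗ v₂ ⁆ᵗ) ⁅ v₀ ◃ᵗ v₁ , v₂ ⁆ᵗ refl (g ∷ x ∷ a ∷ []))
        (proj₁ (gK j _) (proj₂ (s j) _ (proj₁ (⁻¹∈ (normalizer (A j)) (gA j) a) a∈A)))
      where
      NK = normalizer (K j)

  trivialSubgroup : Subgroup G
  trivialSubgroup .mem x = Lift c (x ≈ ε)
  trivialSubgroup .resp x≈y (lift x≈ε) = lift (≈-trans (≈-sym x≈y) x≈ε)
  trivialSubgroup .ε∈ = lift ≈-refl
  trivialSubgroup .∙∈ (lift p) (lift q) = lift (≈-trans (∙-cong p q) (identityˡ ε))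
  trivialSubgroup .⁻¹∈ (lift p) = lift (≈-trans (⁻¹-cong p) ε⁻¹≈ε)

  trivialSubgroup-normal : ∀ g → N G (mem trivialSubgroup) g
  trivialSubgroup-normal g = normalizes trivialSubgroup (conj g) (conj (g ⁻¹))
    where
    conj : ∀ g x → mem trivialSubgroup x → mem trivialSubgroup (g ◃ x)
    conj g x (lift x≈ε) = lift (≈-trans (◃-cong ≈-refl x≈ε)
                                        (solve (v₀ ◃ᵗ e) e refl (g ∷ [])))

  -- This is `g⁻¹Kg`. As it is a subgroup, `lower-minimal` reduces the claim that conjugation by `g`
  -- maps a term of the lower central series into `K` to generators.
  conjugate : (K : Subgroup G) → Carrier → Subgroup G
  conjugate K g .mem x = mem K (g ◃ x)
  conjugate K g .resp x≈y = resp K (◃-cong ≈-refl x≈y)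
  conjugate K g .ε∈ = resp K (solve e (v₀ ◃ᵗ e) refl (g ∷ [])) (ε∈ K)
  conjugate K g .∙∈ {x} {y} p q = resp K
    (solve ((v₀ ◃ᵗ v₁) · (v₀ ◃ᵗ v₂)) (v₀ ◃ᵗ (v₁ · v₂)) refl (g ∷ x ∷ y ∷ [])) (∙∈ K p q)
  conjugate K g .⁻¹∈ {x} p = resp K
    (solve (inv (v₀ ◃ᵗ v₁)) (v₀ ◃ᵗ inv v₁) refl (g ∷ x ∷ [])) (⁻¹∈ K p)

  -- Turns `[x, y] ∈ K` into a subgroup condition on `y`, which can then be checked on generators
  -- alone.
  commutator-with : (K : Subgroup G) (x : Carrier) → Subgroup G
  commutator-with K x .mem y = N G (mem K) y × mem K ⁅ x , y ⁆
  commutator-with K x .resp y≈z (yN , xy) =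
    resp (normalizer K) y≈z yN , resp K (⁅⁆-congʳ y≈z) xy
  commutator-with K x .ε∈ = ε∈ (normalizer K) , resp K (≈-sym (⁅,ε⁆ x)) (ε∈ K)
  commutator-with K x .∙∈ (yN , xy) (zN , xz) =
    ∙∈ (normalizer K) yN zN , ⁅,∙⁆∈ K zN xy xz
  commutator-with K x .⁻¹∈ (yN , xy) = ⁻¹∈ (normalizer K) yN , ⁅,⁻¹⁆∈ K yN xy

  -- The lower central series of H.

  module _ (H : Subgroup G) where

    lower : ℕ → Subgroup G
    lower zero = H
    lower (suc j) .mem = γ G (mem H) (suc j)
    lower (suc j) .resp = cong′
    lower (suc j) .ε∈ = unit
    lower (suc j) .∙∈ = mul
    lower (suc j) .⁻¹∈ = inv′

    γ⊆lower : ∀ j {x} → γ G (mem H) j x → mem (lower j) x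
    γ⊆lower zero    x∈ = x∈
    γ⊆lower (suc j) x∈ = x∈

    lower⊆γ : ∀ j {x} → mem (lower j) x → γ G (mem H) j x
    lower⊆γ zero    x∈ = x∈
    lower⊆γ (suc j) x∈ = x∈

    lower-⁅⁆ : ∀ j {x h} → mem (lower j) x → mem H h → mem (lower (suc j)) ⁅ x , h ⁆
    lower-⁅⁆ j {x} {h} x∈γ h∈H = gen (x , h , lower⊆γ j x∈γ , h∈H , ≈-refl)

    lower-minimal : ∀ j (K : Subgroup G) →
      (∀ {x h} → mem (lower j) x → mem H h → mem K ⁅ x , h ⁆) →
      IsSubgroupOf G (lower (suc j)) K
    lower-minimal j K comm x (gen (y , h , y∈γ , h∈H , eq)) =
      resp K (≈-sym eq) (comm (γ⊆lower j y∈γ) h∈H)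
    lower-minimal j K comm _ unit = ε∈ K
    lower-minimal j K comm _ (mul p q) =
      ∙∈ K (lower-minimal j K comm _ p) (lower-minimal j K comm _ q)
    lower-minimal j K comm _ (inv′ p) = ⁻¹∈ K (lower-minimal j K comm _ p)
    lower-minimal j K comm _ (cong′ eq p) = resp K eq (lower-minimal j K comm _ p)

    lower-conj : ∀ {g} → N G (mem H) g → ∀ j x → mem (lower j) x → mem (lower j) (g ◃ x)
    lower-conj gN zero x = proj₁ (gN x)
    lower-conj {g} gN (suc j) = lower-minimal j (conjugate (lower (suc j)) g)
      (λ {x} {h} x∈γ h∈H → resp (lower (suc j))
        (solve ⁅ v₀ ◃ᵗ v₁ , v₀ ◃ᵗ v₂ ⁆ᵗ (v₀ ◃ᵗ ⁅ v₁ , v₂ ⁆ᵗ) refl (g ∷ x ∷ h ∷ []))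
        (lower-⁅⁆ j (lower-conj gN j x x∈γ) (proj₁ (gN h) h∈H)))

    lower-normal : ∀ j {g} → N G (mem H) g → N G (mem (lower j)) g
    lower-normal j gN = normalizes (lower j) (lower-conj gN j)
      (lower-conj (⁻¹∈ (normalizer H) gN) j)

    lower⊆H : ∀ j → IsSubgroupOf G (lower j) H
    lower⊆H zero x x∈H = x∈H
    lower⊆H (suc j) = lower-minimal j H λ x∈γ h∈H →
      let x∈H = lower⊆H j _ x∈γ in
      ∙∈ H (∙∈ H (∙∈ H (⁻¹∈ H x∈H) (⁻¹∈ H h∈H)) x∈H) h∈H

    H-normalizes-lower : ∀ j {h} → mem H h → N G (mem (lower j)) h
    H-normalizes-lower j h∈H = lower-normal j (self-normalizing H _ h∈H)

    -- Induction on `j`: γⱼ₊₂(H) is generated by the `[y, h]` with `y` in γⱼ₊₁(H), and the Hall-Witt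
    -- identity expresses `[[y, h], x]` through `[[h⁻¹, x⁻¹], y]` and `[[x, y⁻¹], h⁻¹]`, to which
    -- the induction hypothesis applies.
    lower-⁅lower⁆ : ∀ i j {x y} → mem (lower i) x → mem (lower j) y →
                    mem (lower (suc (i + j))) ⁅ x , y ⁆
    lower-⁅lower⁆ i zero x∈ y∈
      rewrite +-identityʳ i = lower-⁅⁆ i x∈ y∈
    lower-⁅lower⁆ i (suc j) {x} x∈ y∈ = proj₂ (lower-minimal j (commutator-with K x)
        (λ y∈ h∈ → KN (suc j) (lower-⁅⁆ j y∈ h∈) , ⁅⁆∈-swap K (generator y∈ h∈)) _ y∈)
      where
      K = lower (suc (i + suc j))
      KN : ∀ s {z} → mem (lower s) z → N G (mem K) z
      KN s z∈ = H-normalizes-lower _ (lower⊆H s _ z∈)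
      generator : ∀ {y h} → mem (lower j) y → mem H h → mem K ⁅ ⁅ y , h ⁆ , x ⁆
      generator {y} {h} y∈ h∈ = ⁅⁅⁆⁆∈ K (KN j y∈) (KN 0 h∈) (KN i x∈)
        (subst (λ s → mem (lower s) ⁅ ⁅ h ⁻¹ , x ⁻¹ ⁆ , y ⁆) (cong suc (sym (+-suc i j)))
          (lower-⁅lower⁆ (suc i) j
            (⁅⁆∈-swap (lower (suc i)) (lower-⁅⁆ i (⁻¹∈ (lower i) x∈) (⁻¹∈ H h∈))) y∈))
        (subst (λ s → mem (lower (suc s)) ⁅ ⁅ x , y ⁻¹ ⁆ , h ⁻¹ ⁆) (sym (+-suc i j))
          (lower-⁅⁆ (suc (i + j)) (lower-⁅lower⁆ i j x∈ (⁻¹∈ (lower j) y∈)) (⁻¹∈ H h∈)))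

    lower-trivial-suc : ∀ j → Trivial G (mem (lower j)) → Trivial G (mem (lower (suc j)))
    lower-trivial-suc j triv x x∈ = Lift.lower (lower-minimal j trivialSubgroup
      (λ y∈ _ → lift (≈-trans (⁅⁆-congˡ (triv _ y∈)) (⁅ε,⁆ _))) x x∈)

    lower-trivial : ∀ {n} → Trivial G (mem (lower n)) → ∀ k →
                    Trivial G (mem (lower (k + n)))
    lower-trivial triv zero    = triv
    lower-trivial triv (suc k) = lower-trivial-suc _ (lower-trivial triv k)

    -- The subgroups Eₖ.

    -- E m j is Eₘ₋ⱼ, which is 1 for j ≥ m.
    E : ℕ → ℕ → Subgroup G
    E zero    j       = trivialSubgroup
    E (suc m) zero    = stabilizer (E m) (λ j → mem (lower j))
    E (suc m) (suc j) = E m j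

    E-normal : ∀ {g} → N G (mem H) g → ∀ m j → N G (mem (E m j)) g
    E-normal gN zero    j       = trivialSubgroup-normal _
    E-normal gN (suc m) zero    = stabilizer-normal (E m) lower (E-normal gN m)
                                    (λ j → lower-normal j gN)
    E-normal gN (suc m) (suc j) = E-normal gN m j

    H-normalizes-E : ∀ m j {h} → mem H h → N G (mem (E m j)) h
    H-normalizes-E m j h∈H = E-normal (self-normalizing H _ h∈H) m j

    E-normalizes-E : ∀ m j i {x} → mem (E m j) x → N G (mem (E m (suc (j + i)))) x
    E-normalizes-E zero    j       i x∈ = trivialSubgroup-normal _
    E-normalizes-E (suc m) zero    i x∈ = proj₁ (x∈ i)
    E-normalizes-E (suc m) (suc j) i x∈ = E-normalizes-E m j i x∈

    E-⁅lower⁆ : ∀ m j i {x g} → mem (E m j) x → mem (lower i) g →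
                mem (E m (suc (j + i))) ⁅ x , g ⁆
    E-⁅lower⁆ zero    j       i (lift x≈ε) g∈ =
      lift (≈-trans (⁅⁆-congˡ x≈ε) (⁅ε,⁆ _))
    E-⁅lower⁆ (suc m) zero    i x∈ g∈ = proj₂ (x∈ i) _ g∈
    E-⁅lower⁆ (suc m) (suc j) i x∈ g∈ = E-⁅lower⁆ m j i x∈ g∈

    E-trivial : ∀ m j → m ≤ j → ∀ {x} → mem (E m j) x → x ≈ ε
    E-trivial zero    j       m≤j       x∈ = Lift.lower x∈
    E-trivial (suc m) (suc j) (s≤s m≤j) x∈ = E-trivial m j m≤j x∈

    E-trivial-normal : ∀ m j → m ≤ j → ∀ g → N G (mem (E m j)) g
    E-trivial-normal zero    j       m≤j       = trivialSubgroup-normal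
    E-trivial-normal (suc m) (suc j) (s≤s m≤j) = E-trivial-normal m j m≤j

    -- The bound is `n - i ≤ m - j` without subtraction. Induction on `m`: a commutator with γⱼ₊₁(H)
    -- raises `i` by `j + 1`, which makes up for the lower index of the E it has to reach. At
    -- `m = 0` the bound forces `n ≤ i`, where γᵢ₊₁(H) is trivial.
    lower⊆E : ∀ {n} → Trivial G (mem (lower n)) → ∀ m j i → n + j ≤ i + m →
              IsSubgroupOf G (lower i) (E m j)
    lower⊆E {n} triv zero j i n+j≤i x x∈ = lift (lower-trivial triv (i ∸ n) x
      (subst (λ k → mem (lower k) x)
        (sym (m∸n+n≡m (≤-trans (m≤m+n n j) (≤-trans n+j≤i (≤-reflexive (+-identityʳ i)))))) x∈))
    lower⊆E {n} triv (suc m) zero i n≤ x x∈ j =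
      H-normalizes-E m j (lower⊆H i x x∈) ,
      λ a a∈ → lower⊆E triv m j (suc (i + j)) bound _ (lower-⁅lower⁆ i j x∈ a∈)
      where
      bound : n + j ≤ suc (i + j) + m
      bound = ≤-trans (+-monoˡ-≤ j (subst (_≤ i + suc m) (+-identityʳ n) n≤))
        (≤-reflexive (trans (+-assoc i (suc m) j)
          (trans (cong (i +_) (cong suc (+-comm m j)))
            (trans (+-suc i (j + m)) (cong suc (sym (+-assoc i j m)))))))
    lower⊆E {n} triv (suc m) (suc j) i n≤ = lower⊆E triv m j i
      (≤-pred (subst₂ _≤_ (+-suc n j) (+-suc i m) n≤))

    -- Testing the Eₖ on subsets with the same centralizers as the γⱼ(H).

    module _ (P : ℕ → Subset G) (P⊆lower : ∀ j → _⊆_ G (P j) (mem (lower j)))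
             (CP⊆C : ∀ j → _⊆_ G (C G (P j)) (C G (mem (lower j)))) where

      -- The Hall–Witt identity for x, γⱼ₊₁(H) and Pₗ expresses membership of
      -- [x, γⱼ₊₁(H)] in its E through that of [x, γⱼ₊ₗ₊₂(H)], so the induction on t
      -- runs downwards in j.
      mutual
        ⁅P⁆⇒⁅lower⁆ : ∀ m t j {x} → m ≤ j + t → Stabilizes (E m) P x →
                      ∀ g → mem (lower j) g → mem (E m j) ⁅ x , g ⁆
        ⁅P⁆⇒⁅lower⁆ m t j {x} m≤j+t s g g∈ with ≤-<-connex m j
        -- Base of the downward induction: `E m j` is trivial, so `x` centralizes `P j`, and hence
        -- all of γⱼ₊₁(H) by `CP⊆C`.
        ... | inj₁ m≤j = resp (E m j) (≈-sym (commute⇒⁅⁆≈ε (CP⊆C j x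
                (λ a a∈P → ⁅⁆≈ε⇒commute (E-trivial m j m≤j (proj₂ (s j) a a∈P))) g g∈)))
                (ε∈ (E m j))
        ⁅P⁆⇒⁅lower⁆ m zero j m≤j+t s g g∈ | inj₂ j<m =
          ⊥-elim (<⇒≱ j<m (≤-trans m≤j+t (≤-reflexive (+-identityʳ j))))
        ⁅P⁆⇒⁅lower⁆ m (suc t) j {x} m≤j+t s g g∈ | inj₂ j<m = E-generated m j j<m
          (λ i → let NK = normalizer (E m (suc (j + i)))
                     xN = proj₁ (s (suc (j + i)))
                     gN = gN i in
                 ∙∈ NK (∙∈ NK (∙∈ NK (⁻¹∈ NK xN) (⁻¹∈ NK gN)) xN) gN)
          hallWitt
          where
          gN : ∀ i → N G (mem (E m (suc (j + i)))) g
          gN i = H-normalizes-E m _ (lower⊆H j g g∈)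
          hallWitt : ∀ i h → P i h → mem (E m (suc (j + i))) ⁅ ⁅ x , g ⁆ , h ⁆
          hallWitt i h h∈P = ⁅⁅⁆⁆∈ K (proj₁ (s (suc (j + i)))) (gN i)
            (H-normalizes-E m _ (lower⊆H i h h∈))
            (⁅⁆∈-swap K (⁅P⁆⇒⁅lower⁆ m t (suc (j + i)) bound s _
              (lower-⁅lower⁆ j i (⁻¹∈ (lower j) g∈) (⁻¹∈ (lower i) h∈))))
            -- This factor comes straight from the hypothesis on `P`: `[h, x⁻¹]` lies in `E m i`,
            -- and its commutator with `g⁻¹` in γⱼ₊₁(H) lies in `E m (suc (i + j))`.
            (subst (λ k → mem (E m (suc k)) ⁅ ⁅ h , x ⁻¹ ⁆ , g ⁻¹ ⁆) (+-comm i j)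
              (E-⁅lower⁆ m i j
                (⁅⁆∈-swap (E m i) (⁅⁻¹,⁆∈ (E m i) (proj₁ (s i)) (proj₂ (s i) h h∈P)))
                (⁻¹∈ (lower j) g∈)))
            where
            K = E m (suc (j + i))
            h∈ = P⊆lower i h h∈P
            bound : m ≤ suc (j + i) + t
            bound = ≤-trans m≤j+t (≤-trans (≤-reflexive (+-suc j t))
                      (s≤s (+-monoˡ-≤ t (m≤m+n j i))))

        E-generated : ∀ m j → j < m → ∀ {x} → (∀ i → N G (mem (E m (suc (j + i)))) x) →
                      (∀ i a → P i a → mem (E m (suc (j + i))) ⁅ x , a ⁆) → mem (E m j) x
        E-generated (suc m) zero    _         xN xP j =
          -- The index drops from `suc m` to `m` here, which makes the mutual recursion
          -- well-founded; `t = m` meets the bound for every `j`.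
          xN j , ⁅P⁆⇒⁅lower⁆ m m j (m≤n+m m j) (λ i → xN i , xP i)
        E-generated (suc m) (suc j) (s≤s j<m) xN xP = E-generated m j j<m xN xP

    -- The envelope D and its nilpotency class.

    envelope : ℕ → Subgroup G
    envelope n = E n 0 ∩ stabilizer (λ j → E n (suc j)) (λ j → mem (E n j))

    envelope-normal : ∀ n → IsNormalizerNormal G (envelope n) H
    envelope-normal n g gN = ∩-normal (E n 0) (stabilizer (λ j → E n (suc j)) (λ j → mem (E n j)))
      (E-normal gN n 0)
      (stabilizer-normal (λ j → E n (suc j)) (E n)
        (λ j → E-normal gN n (suc j)) (λ j → E-normal gN n j))

    H⊆envelope : ∀ n → Trivial G (γ G (mem H) n) → IsSubgroupOf G H (envelope n)
    H⊆envelope n triv h h∈H =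
      lower⊆E {n} (λ x → triv x ∘ lower⊆γ n) n 0 0 (≤-reflexive (+-identityʳ n)) h h∈H ,
      λ j → H-normalizes-E n (suc j) h∈H ,
            λ a a∈E → ⁅⁆∈-swap (E n (suc j))
              (subst (λ k → mem (E n (suc k)) ⁅ a , h ⁆) (+-identityʳ j) (E-⁅lower⁆ n j 0 a∈E h∈H))

  lower-mono : (H K : Subgroup G) → IsSubgroupOf G H K → ∀ j →
               IsSubgroupOf G (lower H j) (lower K j)
  lower-mono H K H⊆K zero    = H⊆K
  lower-mono H K H⊆K (suc j) = lower-minimal H j (lower K (suc j))
    λ x∈ h∈ → lower-⁅⁆ K j (lower-mono H K H⊆K j _ x∈) (H⊆K _ h∈)

  -- The stabilizer condition on D says `[D, Eₙ₋ⱼ] ≤ Eₙ₋ⱼ₋₁`, so each further commutator with D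
  -- descends one step, starting from `D ≤ Eₙ`.
  lower-envelope⊆E : ∀ H n j → IsSubgroupOf G (lower (envelope H n) j) (E H n j)
  lower-envelope⊆E H n zero x x∈ = proj₁ x∈
  lower-envelope⊆E H n (suc j) = lower-minimal (envelope H n) j (E H n (suc j))
    λ {x} x∈ h∈ → ⁅⁆∈-swap (E H n (suc j)) (proj₂ (proj₂ h∈ j) x (lower-envelope⊆E H n j x x∈))

  envelope-nilpotent : ∀ H n → NilpotentOfClass G H n → NilpotentOfClass G (envelope H n) n
  envelope-nilpotent H n (triv , nontriv) =
    (λ x x∈ → E-trivial H n n ≤-refl (lower-envelope⊆E H n n x (γ⊆lower D n x∈))) ,
    -- The class cannot drop, because the lower central series of `H` lies termwise in that of D.
    λ m m<n D-triv → nontriv m m<n λ x x∈ →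
      D-triv x (lower⊆γ D m (lower-mono H D H⊆D m x (γ⊆lower H m x∈)))
    where
    D = envelope H n
    H⊆D = H⊆envelope H n triv

  -- Correctness of the formulas.

  Sat-⋀ : ∀ {n k} {F : Fin n → Formula k} {ρ} → Sat G (⋀ F) ρ ⇔ (∀ i → Sat G (F i) ρ)
  Sat-⋀ {zero}  = mk⇔ (λ _ ()) (λ { _ (lift ()) })
  Sat-⋀ {suc n} {F = F} = mk⇔
    (λ { (s , _) zero → s ; (_ , s) (suc i) → Equivalence.to (Sat-⋀ {F = F ∘ suc}) s i })
    (λ s → s zero , Equivalence.from (Sat-⋀ {F = F ∘ suc}) (s ∘ suc))

  ⟦weaken⟧ : ∀ {k} (t : Term k) x ρ → ⟦_⟧t G (weaken t) (extend x ρ) ≡ ⟦_⟧t G t ρ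
  ⟦weaken⟧ (var i) x ρ = refl
  ⟦weaken⟧ e       x ρ = refl
  ⟦weaken⟧ (s · t) x ρ = cong₂ _∙_ (⟦weaken⟧ s x ρ) (⟦weaken⟧ t x ρ)
  ⟦weaken⟧ (inv t) x ρ = cong _⁻¹ (⟦weaken⟧ t x ρ)

  module _ {d n : ℕ} (b : Fin n → Fin d → Carrier) where

    Interprets : ∀ {k} → Params d n k → (Fin k → Carrier) → Set c
    Interprets p ρ = ∀ j i → ρ (p j i) ≡ b j i

    -- Uniform in the context, so that it still applies below a quantifier, where the parameters sit
    -- at shifted variables.
    Expresses : TermPredicate d n → Subset G → Set (c Level.⊔ ℓ)
    Expresses F S = ∀ {k} {p : Params d n k} {ρ} → Interprets p ρ → ∀ t →
                    Sat G (F p t) ρ ⇔ S (⟦_⟧t G t ρ)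

    inNormalizer-correct : ∀ {F : TermPredicate d n} {S} → Expresses F S →
                           Expresses (inNormalizer F) (N G S)
    inNormalizer-correct {F} {S} F-correct {p = p} {ρ} p≡b t = mk⇔
      (λ s h → (λ h∈S → to (at h) (proj₁ (s h) (from (at₀ h) h∈S))) ,
               (λ gh∈S → to (at₀ h) (proj₂ (s h) (from (at h) gh∈S))))
      (λ s h → (λ q → from (at h) (proj₁ (s h) (to (at₀ h) q))) ,
               (λ q → from (at₀ h) (proj₂ (s h) (to (at h) q))))
      where
      open Equivalence
      at₀ : ∀ h → Sat G (F (weakenParams p) (var zero)) (extend h ρ) ⇔ S h
      at₀ h = F-correct p≡b (var zero)
      at : ∀ h → Sat G (F (weakenParams p) (weaken t ◃ᵗ var zero)) (extend h ρ) ⇔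
                 S (⟦_⟧t G t ρ ◃ h)
      at h = subst (λ g → Sat G (F (weakenParams p) (weaken t ◃ᵗ var zero)) (extend h ρ) ⇔
                          S (g ◃ h))
                   (⟦weaken⟧ t h ρ) (F-correct p≡b (weaken t ◃ᵗ var zero))

    module _ (H : Subgroup G) (b∈lower : ∀ j i → mem (lower H (toℕ j)) (b j i))
             (Cb⊆C : ∀ j x → (∀ i → x ∙ b j i ≈ b j i ∙ x) →
                     C G (mem (lower H (toℕ j))) x)
             (triv : Trivial G (mem (lower H n))) where
      open Equivalence

      -- Defined for every natural `j`, as `E-generated` expects, and empty for `j ≥ n`.
      Parameter : ℕ → Subset G
      Parameter j x = Σ[ j′ ∈ Fin n ] Σ[ i ∈ Fin d ] (toℕ j′ ≡ j × Lift ℓ (x ≡ b j′ i))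

      Parameter⊆lower : ∀ j → _⊆_ G (Parameter j) (mem (lower H j))
      Parameter⊆lower j x (j′ , i , refl , lift refl) = b∈lower j′ i

      C-Parameter⊆C : ∀ j → _⊆_ G (C G (Parameter j)) (C G (mem (lower H j)))
      C-Parameter⊆C j x x∈C with ≤-<-connex n j
      -- Here γⱼ₊₁(H) is trivial, so every element centralizes it.
      ... | inj₁ n≤j = λ a a∈ →
        let a≈ε = lower-trivial H triv (j ∸ n) a
                    (subst (λ k → mem (lower H k) a) (sym (m∸n+n≡m n≤j)) a∈)
        in ≈-trans (∙-congˡ a≈ε) (≈-trans (≈-trans (identityʳ x) (≈-sym (identityˡ x)))
                                          (∙-congʳ (≈-sym a≈ε)))
      ... | inj₂ j<n = subst (λ k → C G (mem (lower H k)) x) (toℕ-fromℕ< j<n)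
        (Cb⊆C (fromℕ< j<n) x λ i → x∈C _ (fromℕ< j<n , i , toℕ-fromℕ< j<n , lift refl))

      -- `E-generated` passes from the parameters back to the whole γⱼ₊₁(H). The cut-off at `n`
      -- loses nothing, since `m ≤ n` makes `E H m j` trivial for `j ≥ n`.
      inE-correct : ∀ m j → m ≤ n → Expresses (inE m j) (mem (E H m j))
      inE-correct zero    j       _   p≡b t = mk⇔ (λ s → s) (λ s → s)
      inE-correct (suc m) (suc j) m<n p≡b t = inE-correct m j (<⇒≤ m<n) p≡b t
      inE-correct (suc m) zero    m<n {p = p} {ρ} p≡b t = mk⇔
        (λ s → E-generated H Parameter Parameter⊆lower C-Parameter⊆C (suc m) 0 (s≤s z≤n)
          (λ j → normal s j)
          (λ { _ a (j , i , refl , lift refl) → to (comm j i) (to Sat-⋀ (proj₂ (to Sat-⋀ s j)) i) }))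
        (λ s → from Sat-⋀ λ j →
          from (norm j) (proj₁ (s (toℕ j))) ,
          from Sat-⋀ λ i → from (comm j i) (proj₂ (s (toℕ j)) _ (b∈lower j i)))
        where
        norm : ∀ (j : Fin n) → Sat G (inNormalizer (inE m (toℕ j)) p t) ρ ⇔
                               N G (mem (E H m (toℕ j))) (⟦_⟧t G t ρ)
        norm j = inNormalizer-correct {inE m (toℕ j)} (inE-correct m (toℕ j) (<⇒≤ m<n)) p≡b t
        comm : ∀ j i → Sat G (inE m (toℕ j) p ⁅ t , var (p j i) ⁆ᵗ) ρ ⇔
                       mem (E H m (toℕ j)) ⁅ ⟦_⟧t G t ρ , b j i ⁆
        comm j i = subst (λ y → Sat G (inE m (toℕ j) p ⁅ t , var (p j i) ⁆ᵗ) ρ ⇔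
                                mem (E H m (toℕ j)) ⁅ ⟦_⟧t G t ρ , y ⁆)
                         (p≡b j i) (inE-correct m (toℕ j) (<⇒≤ m<n) p≡b ⁅ t , var (p j i) ⁆ᵗ)
        normal : Sat G (inE (suc m) zero p t) ρ → ∀ j → N G (mem (E H m j)) (⟦_⟧t G t ρ)
        normal s j with ≤-<-connex n j
        ... | inj₁ n≤j = E-trivial-normal H m j (≤-trans (<⇒≤ m<n) n≤j) _
        ... | inj₂ j<n = subst (λ k → N G (mem (E H m k)) (⟦_⟧t G t ρ)) (toℕ-fromℕ< j<n)
                               (to (norm (fromℕ< j<n)) (proj₁ (to Sat-⋀ s (fromℕ< j<n))))

      inEnvelope-correct : Expresses inEnvelope (mem (envelope H n))
      inEnvelope-correct {p = p} {ρ} p≡b t = mk⇔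
        -- The normalizer half of the stabilizer condition follows from membership in Eₙ.
        (λ (s , u) → to inE₀ s , λ j → E-normalizes-E H n 0 j (to inE₀ s) , comm-all u j)
        (λ (s , u) → from inE₀ s ,
          from Sat-⋀ λ j y q → from (comm j y) (proj₂ (u (toℕ j)) y (to (at₀ j y) q)))
        where
        inE₀ = inE-correct n 0 ≤-refl p≡b t
        at₀ : ∀ (j : Fin n) y → Sat G (inE n (toℕ j) (weakenParams p) (var zero)) (extend y ρ) ⇔
                                mem (E H n (toℕ j)) y
        at₀ j y = inE-correct n (toℕ j) ≤-refl p≡b (var zero)
        inComm : Fin n → Formula _
        inComm j = inE n (suc (toℕ j)) (weakenParams p) ⁅ weaken t , var zero ⁆ᵗ
        comm : ∀ j y → Sat G (inComm j) (extend y ρ) ⇔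
                       mem (E H n (suc (toℕ j))) ⁅ ⟦_⟧t G t ρ , y ⁆
        comm j y = subst (λ g → Sat G (inComm j) (extend y ρ) ⇔ mem (E H n (suc (toℕ j))) ⁅ g , y ⁆)
                         (⟦weaken⟧ t y ρ)
                         (inE-correct n (suc (toℕ j)) ≤-refl p≡b ⁅ weaken t , var zero ⁆ᵗ)
        comm-all : Sat G (⋀ λ j → ∀f (inE n (toℕ j) (weakenParams p) (var zero) ⇒f inComm j)) ρ →
                   ∀ j a → mem (E H n j) a → mem (E H n (suc j)) ⁅ ⟦_⟧t G t ρ , a ⁆
        comm-all u j a a∈E with ≤-<-connex n j
        ... | inj₁ n≤j = resp (E H n (suc j))
                (≈-sym (≈-trans (⁅⁆-congʳ (E-trivial H n j n≤j a∈E)) (⁅,ε⁆ _)))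
                (ε∈ (E H n (suc j)))
        ... | inj₂ j<n = subst (λ k → mem (E H n (suc k)) ⁅ ⟦_⟧t G t ρ , a ⁆) (toℕ-fromℕ< j<n)
          (to (comm j′ a) (to Sat-⋀ u j′ a (from (at₀ j′ a)
            (subst (λ k → mem (E H n k) a) (sym (toℕ-fromℕ< j<n)) a∈E))))
          where j′ = fromℕ< j<n

    parameters : Fin (d * n) → Carrier
    parameters v = b (proj₂ (remQuot {d} n v)) (proj₁ (remQuot {d} n v))

    parameters-interpret : ∀ x → Interprets (λ j i → suc (combine i j)) (extend x parameters)
    parameters-interpret x j i =
      cong (λ q → b (proj₂ q) (proj₁ q)) (remQuot-combine i j)

  -- Finite lists with the centralizer of a given subgroup.

  module _ (em : ∀ {a : Level} → ExcludedMiddle a) where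

    module _ (B : Subgroup G) where

      Unsettled : Subset G → Set (c Level.⊔ ℓ)
      Unsettled A = Σ[ b ∈ Carrier ] (mem B b × Σ[ x ∈ Carrier ] (C G A x × ¬ (x ∙ b ≈ b ∙ x)))

      next : Subset G → Carrier
      next A with em {P = Unsettled A}
      ... | yes (b , _) = b
      -- Once the centralizer is that of `B`, the list is padded with `ε`, which lies in `B`, so
      -- that it can have any prescribed length.
      ... | no _        = ε

      next∈B : ∀ A → mem B (next A)
      next∈B A with em {P = Unsettled A}
      ... | yes (_ , b∈B , _) = b∈B
      ... | no _              = ε∈ B

      prefix : ℕ → Subset G
      prefix zero    x = Lift (c Level.⊔ ℓ) ⊥
      prefix (suc i) x = prefix i x ⊎ Lift ℓ (x ≡ next (prefix i))

      greedy : ℕ → Carrier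
      greedy i = next (prefix i)

      C-prefix-antitone : ∀ {i k} → i ≤′ k → _⊆_ G (C G (prefix k)) (C G (prefix i))
      C-prefix-antitone ≤′-refl x x∈C = x∈C
      C-prefix-antitone (≤′-step i≤k) x x∈C =
        C-prefix-antitone i≤k x (λ a a∈ → x∈C a (inj₁ a∈))

      commute-greedy⇒C-prefix : ∀ k x → (∀ i → i < k → x ∙ greedy i ≈ greedy i ∙ x) →
                                C G (prefix k) x
      commute-greedy⇒C-prefix (suc k) x comm a (inj₁ a∈) =
        commute-greedy⇒C-prefix k x (λ i i<k → comm i (m≤n⇒m≤1+n i<k)) a a∈
      commute-greedy⇒C-prefix (suc k) x comm a (inj₂ (lift refl)) = comm k ≤-refl

      Settled : ℕ → Set (c Level.⊔ ℓ)
      Settled k = _⊆_ G (C G (prefix k)) (C G (mem B))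

      settled-mono : ∀ {i k} → i ≤ k → Settled i → Settled k
      settled-mono i≤k settled x x∈C = settled x (C-prefix-antitone (≤⇒≤′ i≤k) x x∈C)

      -- Some `x` centralizes the prefix but not all of `B`. The element added by `next` fails to
      -- commute with such an `x`, which therefore leaves the centralizer.
      unsettled⇒descends : ∀ k → ¬ Settled k →
                           _⊂_ G (C G (prefix (suc k))) (C G (prefix k))
      unsettled⇒descends k ¬settled =
        C-prefix-antitone (≤′-step ≤′-refl) , strict
        where
        strict : ¬ (_⊆_ G (C G (prefix k)) (C G (prefix (suc k))))
        strict C⊆C with em {P = Unsettled (prefix k)} | C⊆C
        ... | yes (b , _ , x , x∈C , ¬xb≈bx) | C⊆C′ = ¬xb≈bx (C⊆C′ x x∈C b (inj₂ (lift refl)))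
        ... | no ¬unsettled | _ = ¬settled λ x x∈C b b∈B → decidable-stable em
          λ ¬xb≈bx → ¬unsettled (b , b∈B , x , x∈C , ¬xb≈bx)

      settled-by-dimension : ∀ {d} → HasCDim G d → Settled d
      settled-by-dimension {d} (_ , ¬chain) = decidable-stable em λ ¬settled →
        -- If prefix `d` is unsettled, so are all earlier ones; with the empty prefix, whose
        -- centralizer is G, they give `d + 1` strict descents.
        ¬chain (prefix , (λ g a ()) , λ i i<1+d →
          unsettled⇒descends i λ settled → ¬settled (settled-mono (≤-pred i<1+d) settled))

      settled-by-MC : MC G → Σ[ k ∈ ℕ ] Settled k
      settled-by-MC mc = decidable-stable em λ never →
        mc (prefix , λ i → unsettled⇒descends i λ settled → never (i , settled))

    -- A settled list stays settled when lengthened, so the maximum of the separate lengths works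
    -- for all indices below `n`.
    settled-uniformly : MC G → (B : ℕ → Subgroup G) → ∀ n →
                        Σ[ d ∈ ℕ ] (∀ j → j < n → Settled (B j) d)
    settled-uniformly mc B zero = zero , λ j ()
    settled-uniformly mc B (suc n) with settled-uniformly mc B n | settled-by-MC (B n) mc
    ... | d , settled | k , settledₙ = d ⊔ k , below
      where
      below : ∀ j → j < suc n → Settled (B j) (d ⊔ k)
      below j j<1+n with m≤n⇒m<n∨m≡n (≤-pred j<1+n)
      ... | inj₁ j<n  = settled-mono (B j) (m≤m⊔n d k) (settled j j<n)
      ... | inj₂ refl = settled-mono (B n) (m≤n⊔m d k) settledₙ

    -- Definability of the envelope and conclusion.

    envelope-definedBy : ∀ {d n} (H : Subgroup G) → NilpotentOfClass G H n →
      (∀ j → j < n → Settled (lower H j) d) →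
      Σ[ a ∈ (Fin (d * n) → Carrier) ] DefinedBy G (envelopeFormula d n) a (mem (envelope H n))
    envelope-definedBy {d} {n} H (triv , _) settled = parameters b , λ g →
      let correct = inEnvelope-correct b H
            (λ j i → next∈B (lower H (toℕ j)) _)
            (λ j x comm → settled (toℕ j) (toℕ<n j) x
              (commute-greedy⇒C-prefix (lower H (toℕ j)) d x λ i i<d →
                subst (λ k → x ∙ greedy (lower H (toℕ j)) k ≈ greedy (lower H (toℕ j)) k ∙ x)
                  (toℕ-fromℕ< i<d) (comm (fromℕ< i<d))))
            (λ x → triv x ∘ lower⊆γ H n)
            (parameters-interpret b g) (var zero)
      in Equivalence.from correct , Equivalence.to correct
      where
      b : Fin n → Fin d → Carrier
      b j i = greedy (lower H (toℕ j)) (toℕ i)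

theorem3p4 : (∀ {a : Level} → ExcludedMiddle a) →
    ((∀ {c ℓ : Level} (G : Group c ℓ) → MC G →
    (H : Subgroup G) (n : ℕ) → NilpotentOfClass G H n →
    Σ[ D ∈ Subgroup G ]
    (Definable G (mem D) × IsSubgroupOf G H D × IsNormalizerNormal G D H
    × NilpotentOfClass G D n))
    ×ω
    ((d n : ℕ) → 1 ≤ d → 1 ≤ n →
    ∃Formula (suc (d * n)) (λ φ →
    ∀ {c ℓ : Level} (G : Group c ℓ) → HasCDim G d →
    (H : Subgroup G) → NilpotentOfClass G H n →
    Σ[ a ∈ (Fin (d * n) → Group.Carrier G) ] Σ[ D ∈ Subgroup G ]
    (DefinedBy G φ a (mem D) × NilpotentOfClass G D n
    × IsSubgroupOf G H D × IsNormalizerNormal G D H))))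
theorem3p4 em =
  (λ G mc H n nil →
    -- The chain condition gives a length that depends on `H`; it takes the place of the dimension
    -- in the same family of formulas.
    let d , settled = settled-uniformly G em mc (lower G H) n
        a , defines = envelope-definedBy G em H nil settled
    in envelope G H n , (d * n , envelopeFormula d n , a , defines) ,
       H⊆envelope G H n (proj₁ nil) , envelope-normal G H n ,
       envelope-nilpotent G H n nil)
  ,ω
  -- The formula is fixed before `G` and `H`; dimension `d` settles every γⱼ(H) with `d` elements.
  (λ d n _ _ → envelopeFormula d n ,φ λ G dim H nil →
    let a , defines = envelope-definedBy G em H nil
                        (λ j _ → settled-by-dimension G em (lower G H j) dim)
    in a , envelope G H n , defines , envelope-nilpotent G H n nil ,
       H⊆envelope G H n (proj₁ nil) , envelope-normal G H n)
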